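{- Let $x_1,x_2,\ldots,y_1,y_2,\ldots$ be indeterminates. For every integer $n\ge 1$, the identity $$\sum_{k=1}^{n}\frac{y_k}{x_k}=\cfrac{a_1}{b_1+\cfrac{a_2}{b_2+\cdots+\cfrac{a_{2n}}{b_{2n}}}}$$ holds in the field of rational functions over $\mathbb{Q}$ in these indeterminates, where $a_1=y_1$, $b_1=x_1-y_1$, and for $k\ge 1$ $$a_{2k}=\theta y_{k-1},\quad a_{2k+1}=\theta^2 y_{k-1},\quad b_{2k}=x_{k-1},\quad b_{2k+1}=\frac{\theta^2x_{k-1}-\theta^2y_{k-1}}{x_{k-1}}.$$
   Context: For a sequence $(u_k)_{k\ge 1}$ of indeterminates, set $u_0=1$ (so $x_0=y_0=1$) and define, for $k\ge 0$, $\theta u_k=\dfrac{u_{k+1}}{u_k}$ and $\theta^2u_k=\theta(\theta u_k)=\dfrac{u_{k+2}u_k}{u_{k+1}^2}$. -}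

module Defs where

open import Algebra using (CommutativeRing)
open import Algebra.Apartness using (HeytingField)
open import Data.List using (List; []; _∷_; _++_; map)
open import Data.List.Membership.Propositional using (_∈_)
open import Data.List.Membership.Propositional.Properties using (∈-++⁺ˡ; ∈-++⁺ʳ)
open import Data.List.Relation.Unary.All using (All; []; _∷_)
open import Data.List.Relation.Unary.Any using (here; there)
open import Data.Nat using (ℕ; zero; suc)
import Data.Nat.Properties as ℕ
open import Data.Product using (∃-syntax; _×_; _,_; proj₁; proj₂)
open import Data.Rational as ℚ using (ℚ; 0ℚ; 1ℚ; ∣_∣)
import Data.Rational.Properties as ℚ
open import Data.Sum using (_⊎_; inj₁; inj₂)
open import Data.Unit using (⊤; tt)
open import Function using (_∘_)
open import Level using (0ℓ)
open import Relation.Binary using (Decidable; DecidableEquality; IsEquivalence)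
import Relation.Binary.Properties.DecSetoid as DecSetoidProperties
open import Relation.Binary.PropositionalEquality as ≡ using (_≡_; _≢_; cong; cong₂; subst)
open import Relation.Nullary using (¬_; Dec; yes; no; contradiction; decidable-stable)
open import Relation.Nullary.Decidable using (map′)

Eventually : (ℚ → Set) → Set
Eventually P = ∃[ N ] (∀ t → N ℚ.≤ t → P t)

Away : (ℚ → ℚ) → Set
Away f = ∃[ ε ] (0ℚ ℚ.< ε × Eventually (λ t → ε ℚ.≤ ∣ f t ∣))

0<∣a∣ : ∀ {a} → a ≢ 0ℚ → 0ℚ ℚ.< ∣ a ∣
0<∣a∣ {a} a≢0 = ℚ.≰⇒> λ ∣a∣≤0 → a≢0 (ℚ.∣p∣≡0⇒p≡0 a (ℚ.≤-antisym ∣a∣≤0 (ℚ.0≤∣p∣ a)))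

*-≢0 : ∀ {a b} → a ≢ 0ℚ → b ≢ 0ℚ → a ℚ.* b ≢ 0ℚ
*-≢0 {a} {b} a≢0 b≢0 ab≡0 = ℚ.<⇒≢ 0<∣ab∣ (≡.sym (cong ∣_∣ ab≡0))
  where
  instance
    ∣a∣-pos : ℚ.Positive ∣ a ∣
    ∣a∣-pos = ℚ.positive (0<∣a∣ a≢0)
    ∣b∣-pos : ℚ.Positive ∣ b ∣
    ∣b∣-pos = ℚ.positive (0<∣a∣ b≢0)
  0<∣ab∣ : 0ℚ ℚ.< ∣ a ℚ.* b ∣
  0<∣ab∣ = subst (0ℚ ℚ.<_) (≡.sym (ℚ.∣p*q∣≡∣p∣*∣q∣ a b))
             (ℚ.positive⁻¹ (∣ a ∣ ℚ.* ∣ b ∣) {{ℚ.pos*pos⇒pos ∣ a ∣ ∣ b ∣}})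

away-const : ∀ {a} → a ≢ 0ℚ → Away (λ _ → a)
away-const {a} a≢0 = ∣ a ∣ , 0<∣a∣ a≢0 , 0ℚ , λ _ _ → ℚ.≤-refl

away-step : ∀ a {f} → Away f → Away (λ t → a ℚ.+ t ℚ.* f t)
away-step a {f} (ε , 0<ε , N , far) = ε , 0<ε , N ℚ.⊔ T , bound
  where
  instance
    ε-pos : ℚ.Positive ε
    ε-pos = ℚ.positive 0<ε
    ε-nonZero : ℚ.NonZero ε
    ε-nonZero = ℚ.pos⇒nonZero ε
    ε-nonNeg : ℚ.NonNegative ε
    ε-nonNeg = ℚ.pos⇒nonNeg ε
  T : ℚ
  T = (∣ a ∣ ℚ.+ ε) ℚ.* ℚ.1/ ε
  Tε : T ℚ.* ε ≡ ∣ a ∣ ℚ.+ ε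
  Tε = ≡.trans (ℚ.*-assoc (∣ a ∣ ℚ.+ ε) (ℚ.1/ ε) ε)
         (≡.trans (cong ((∣ a ∣ ℚ.+ ε) ℚ.*_) (ℚ.*-inverseˡ ε)) (ℚ.*-identityʳ (∣ a ∣ ℚ.+ ε)))
  bound : ∀ t → N ℚ.⊔ T ℚ.≤ t → ε ℚ.≤ ∣ a ℚ.+ t ℚ.* f t ∣
  bound t N⊔T≤t = ℚ.≮⇒≥ λ small → ℚ.<-irrefl ≡.refl (ℚ.<-≤-trans (ℚ.+-monoʳ-< ∣ a ∣ small) main)
    where
    open ℚ.≤-Reasoning
    b = t ℚ.* f t
    T≤∣t∣ : T ℚ.≤ ∣ t ∣
    T≤∣t∣ = ℚ.≤-trans (ℚ.≤-trans (ℚ.p≤q⊔p N T) N⊔T≤t) t≤∣t∣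
      where
      t≤∣t∣ : t ℚ.≤ ∣ t ∣
      t≤∣t∣ with ℚ.≤-total 0ℚ t
      ... | inj₁ 0≤t = ℚ.≤-reflexive (≡.sym (ℚ.0≤p⇒∣p∣≡p 0≤t))
      ... | inj₂ t≤0 = ℚ.≤-trans t≤0 (ℚ.0≤∣p∣ t)
    instance
      ∣t∣-nonNeg : ℚ.NonNegative ∣ t ∣
      ∣t∣-nonNeg = ℚ.nonNegative (ℚ.0≤∣p∣ t)
    main : ∣ a ∣ ℚ.+ ε ℚ.≤ ∣ a ∣ ℚ.+ ∣ a ℚ.+ b ∣
    main = begin
      ∣ a ∣ ℚ.+ ε                 ≡⟨ Tε ⟨
      T ℚ.* ε                     ≤⟨ ℚ.*-monoʳ-≤-nonNeg ε T≤∣t∣ ⟩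
      ∣ t ∣ ℚ.* ε
        ≤⟨ ℚ.*-monoˡ-≤-nonNeg ∣ t ∣ (far t (ℚ.≤-trans (ℚ.p≤p⊔q N T) N⊔T≤t)) ⟩
      ∣ t ∣ ℚ.* ∣ f t ∣           ≡⟨ ℚ.∣p*q∣≡∣p∣*∣q∣ t (f t) ⟨
      ∣ b ∣                       ≡⟨ cong ∣_∣ (ℚ.+-identityˡ b) ⟨
      ∣ 0ℚ ℚ.+ b ∣                ≡⟨ cong (λ z → ∣ z ℚ.+ b ∣) (ℚ.+-inverseˡ a) ⟨
      ∣ (ℚ.- a ℚ.+ a) ℚ.+ b ∣     ≡⟨ cong ∣_∣ (ℚ.+-assoc (ℚ.- a) a b) ⟩
      ∣ ℚ.- a ℚ.+ (a ℚ.+ b) ∣     ≤⟨ ℚ.∣p+q∣≤∣p∣+∣q∣ (ℚ.- a) (a ℚ.+ b) ⟩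
      ∣ ℚ.- a ∣ ℚ.+ ∣ a ℚ.+ b ∣   ≡⟨ cong (ℚ._+ ∣ a ℚ.+ b ∣) (ℚ.∣-p∣≡∣p∣ a) ⟩
      ∣ a ∣ ℚ.+ ∣ a ℚ.+ b ∣       ∎

away⇒≢0 : ∀ {f} → Away f → Eventually (λ t → f t ≢ 0ℚ)
away⇒≢0 (ε , 0<ε , N , far) =
  N , λ t N≤t ft≡0 → ℚ.<-irrefl ≡.refl (ℚ.<-≤-trans 0<ε (subst (λ z → ε ℚ.≤ ∣ z ∣) ft≡0 (far t N≤t)))

------------------------------------------------------------------------
-- ℚ[Var]: the free commutative ℚ-algebra on Var, i.e. terms modulo the
-- laws of commutative ℚ-algebras.

module Polynomials (Var : Set) (_≟_ : DecidableEquality Var) where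

  infixl 7 _⊗_
  infixl 6 _⊕_
  infix  8 ⊝_
  infix  4 _≋_

  data Poly : Set where
    con     : ℚ → Poly
    var     : Var → Poly
    _⊕_ _⊗_ : Poly → Poly → Poly
    ⊝_      : Poly → Poly

  data _≋_ : Poly → Poly → Set where
    ≋-refl   : ∀ {p} → p ≋ p
    ≋-sym    : ∀ {p q} → p ≋ q → q ≋ p
    ≋-trans  : ∀ {p q r} → p ≋ q → q ≋ r → p ≋ r
    ⊕-cong   : ∀ {p p′ q q′} → p ≋ p′ → q ≋ q′ → p ⊕ q ≋ p′ ⊕ q′
    ⊗-cong   : ∀ {p p′ q q′} → p ≋ p′ → q ≋ q′ → p ⊗ q ≋ p′ ⊗ q′
    ⊝-cong   : ∀ {p q} → p ≋ q → ⊝ p ≋ ⊝ q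
    ⊕-assoc  : ∀ p q r → (p ⊕ q) ⊕ r ≋ p ⊕ (q ⊕ r)
    ⊕-comm   : ∀ p q → p ⊕ q ≋ q ⊕ p
    ⊕-zero   : ∀ p → con 0ℚ ⊕ p ≋ p
    ⊕-neg    : ∀ p → ⊝ p ⊕ p ≋ con 0ℚ
    ⊗-assoc  : ∀ p q r → (p ⊗ q) ⊗ r ≋ p ⊗ (q ⊗ r)
    ⊗-comm   : ∀ p q → p ⊗ q ≋ q ⊗ p
    ⊗-one    : ∀ p → con 1ℚ ⊗ p ≋ p
    ⊗-distr  : ∀ p q r → p ⊗ (q ⊕ r) ≋ p ⊗ q ⊕ p ⊗ r
    con-⊕    : ∀ c d → con (c ℚ.+ d) ≋ con c ⊕ con d
    con-⊗    : ∀ c d → con (c ℚ.* d) ≋ con c ⊗ con d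

  ≋-isEquivalence : IsEquivalence _≋_
  ≋-isEquivalence = record { refl = ≋-refl ; sym = ≋-sym ; trans = ≋-trans }

  polyRing : CommutativeRing 0ℓ 0ℓ
  polyRing = record
    { Carrier = Poly ; _≈_ = _≋_ ; _+_ = _⊕_ ; _*_ = _⊗_ ; -_ = ⊝_
    ; 0# = con 0ℚ ; 1# = con 1ℚ
    ; isCommutativeRing = record
      { isRing = record
        { +-isAbelianGroup = record
          { isGroup = record
            { isMonoid = record
              { isSemigroup = record
                { isMagma = record { isEquivalence = ≋-isEquivalence ; ∙-cong = ⊕-cong }
                ; assoc = ⊕-assoc }
              ; identity = ⊕-zero , λ p → ≋-trans (⊕-comm _ _) (⊕-zero p) }
            ; inverse = ⊕-neg , λ p → ≋-trans (⊕-comm _ _) (⊕-neg p)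
            ; ⁻¹-cong = ⊝-cong }
          ; comm = ⊕-comm }
        ; *-cong = ⊗-cong
        ; *-assoc = ⊗-assoc
        ; *-identity = ⊗-one , λ p → ≋-trans (⊗-comm _ _) (⊗-one p)
        ; distrib = ⊗-distr
                  , λ p q r → ≋-trans (⊗-comm _ _)
                      (≋-trans (⊗-distr p q r) (⊕-cong (⊗-comm _ _) (⊗-comm _ _)))
        }
      ; *-comm = ⊗-comm } }

  open CommutativeRing polyRing using (ring; commutativeSemiring; setoid; zeroʳ)
  open import Algebra.Properties.Ring ring using (-0#≈0#; -‿distribʳ-*; -‿+-comm)
  open import Algebra.Solver.Ring.NaturalCoefficients.Default commutativeSemiring
    using (solve; _:+_; _:*_; _:=_)
  open import Relation.Binary.Reasoning.Setoid setoid

  Point : Set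
  Point = Var → ℚ

  ev : Point → Poly → ℚ
  ev ρ (con c) = c
  ev ρ (var v) = ρ v
  ev ρ (p ⊕ q) = ev ρ p ℚ.+ ev ρ q
  ev ρ (p ⊗ q) = ev ρ p ℚ.* ev ρ q
  ev ρ (⊝ p)   = ℚ.- ev ρ p

  ev-cong : ∀ ρ {p q} → p ≋ q → ev ρ p ≡ ev ρ q
  ev-cong ρ ≋-refl          = ≡.refl
  ev-cong ρ (≋-sym e)       = ≡.sym (ev-cong ρ e)
  ev-cong ρ (≋-trans e f)   = ≡.trans (ev-cong ρ e) (ev-cong ρ f)
  ev-cong ρ (⊕-cong e f)    = cong₂ ℚ._+_ (ev-cong ρ e) (ev-cong ρ f)
  ev-cong ρ (⊗-cong e f)    = cong₂ ℚ._*_ (ev-cong ρ e) (ev-cong ρ f)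
  ev-cong ρ (⊝-cong e)      = cong ℚ.-_ (ev-cong ρ e)
  ev-cong ρ (⊕-assoc p q r) = ℚ.+-assoc (ev ρ p) (ev ρ q) (ev ρ r)
  ev-cong ρ (⊕-comm p q)    = ℚ.+-comm (ev ρ p) (ev ρ q)
  ev-cong ρ (⊕-zero p)      = ℚ.+-identityˡ (ev ρ p)
  ev-cong ρ (⊕-neg p)       = ℚ.+-inverseˡ (ev ρ p)
  ev-cong ρ (⊗-assoc p q r) = ℚ.*-assoc (ev ρ p) (ev ρ q) (ev ρ r)
  ev-cong ρ (⊗-comm p q)    = ℚ.*-comm (ev ρ p) (ev ρ q)
  ev-cong ρ (⊗-one p)       = ℚ.*-identityˡ (ev ρ p)
  ev-cong ρ (⊗-distr p q r) = ℚ.*-distribˡ-+ (ev ρ p) (ev ρ q) (ev ρ r)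
  ev-cong ρ (con-⊕ c d)     = ≡.refl
  ev-cong ρ (con-⊗ c d)     = ≡.refl

  1≉0 : ¬ con 1ℚ ≋ con 0ℚ
  1≉0 e with ev-cong (λ _ → 0ℚ) e
  ... | ()

  -- ℚ[Var] has decidable equality and no zero divisors: a polynomial is
  -- either 0 or nonzero at all sufficiently generic rational points, where
  -- "generic" means that the variables are chosen one after the other, each
  -- sufficiently large depending on the previous ones.

  Over : (Var → Set) → Poly → Set
  Over S (con c) = ⊤
  Over S (var v) = S v
  Over S (p ⊕ q) = Over S p × Over S q
  Over S (p ⊗ q) = Over S p × Over S q
  Over S (⊝ p)   = Over S p

  Over-map : ∀ {S T} → (∀ {v} → S v → T v) → ∀ p → Over S p → Over T p
  Over-map f (con c) _       = tt
  Over-map f (var v) s       = f s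
  Over-map f (p ⊕ q) (s , t) = Over-map f p s , Over-map f q t
  Over-map f (p ⊗ q) (s , t) = Over-map f p s , Over-map f q t
  Over-map f (⊝ p)   s       = Over-map f p s

  vars : Poly → List Var
  vars (con c) = []
  vars (var v) = v ∷ []
  vars (p ⊕ q) = vars p ++ vars q
  vars (p ⊗ q) = vars p ++ vars q
  vars (⊝ p)   = vars p

  Over-vars : ∀ p → Over (_∈ vars p) p
  Over-vars (con c) = tt
  Over-vars (var v) = here ≡.refl
  Over-vars (p ⊕ q) = Over-map ∈-++⁺ˡ p (Over-vars p) , Over-map (∈-++⁺ʳ (vars p)) q (Over-vars q)
  Over-vars (p ⊗ q) = Over-map ∈-++⁺ˡ p (Over-vars p) , Over-map (∈-++⁺ʳ (vars p)) q (Over-vars q)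
  Over-vars (⊝ p)   = Over-vars p

  module Collect (v : Var) where

    ⟦_⟧ : List Poly → Poly
    ⟦ [] ⟧     = con 0ℚ
    ⟦ c ∷ cs ⟧ = c ⊕ var v ⊗ ⟦ cs ⟧

    add : List Poly → List Poly → List Poly
    add []       ds       = ds
    add (c ∷ cs) []       = c ∷ cs
    add (c ∷ cs) (d ∷ ds) = c ⊕ d ∷ add cs ds

    mul : List Poly → List Poly → List Poly
    mul []       ds = []
    mul (c ∷ cs) ds = add (map (c ⊗_) ds) (con 0ℚ ∷ mul cs ds)

    collect : Poly → List Poly
    collect (con c) = con c ∷ []
    collect (var w) with w ≟ v
    ... | yes _ = con 0ℚ ∷ con 1ℚ ∷ []
    ... | no  _ = var w ∷ []
    collect (p ⊕ q) = add (collect p) (collect q)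
    collect (p ⊗ q) = mul (collect p) (collect q)
    collect (⊝ p)   = map ⊝_ (collect p)

    ⟦add⟧ : ∀ cs ds → ⟦ add cs ds ⟧ ≋ ⟦ cs ⟧ ⊕ ⟦ ds ⟧
    ⟦add⟧ []       ds       = ≋-sym (⊕-zero _)
    ⟦add⟧ (c ∷ cs) []       = ≋-sym (≋-trans (⊕-comm _ _) (⊕-zero _))
    ⟦add⟧ (c ∷ cs) (d ∷ ds) = begin
      (c ⊕ d) ⊕ var v ⊗ ⟦ add cs ds ⟧
        ≈⟨ ⊕-cong ≋-refl (⊗-cong ≋-refl (⟦add⟧ cs ds)) ⟩
      (c ⊕ d) ⊕ var v ⊗ (⟦ cs ⟧ ⊕ ⟦ ds ⟧)
        ≈⟨ solve 5 (λ c d v a b → (c :+ d) :+ v :* (a :+ b) := (c :+ v :* a) :+ (d :+ v :* b))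
             ≋-refl c d (var v) ⟦ cs ⟧ ⟦ ds ⟧ ⟩
      (c ⊕ var v ⊗ ⟦ cs ⟧) ⊕ (d ⊕ var v ⊗ ⟦ ds ⟧) ∎

    ⟦scale⟧ : ∀ c ds → ⟦ map (c ⊗_) ds ⟧ ≋ c ⊗ ⟦ ds ⟧
    ⟦scale⟧ c []       = ≋-sym (zeroʳ c)
    ⟦scale⟧ c (d ∷ ds) = begin
      c ⊗ d ⊕ var v ⊗ ⟦ map (c ⊗_) ds ⟧ ≈⟨ ⊕-cong ≋-refl (⊗-cong ≋-refl (⟦scale⟧ c ds)) ⟩
      c ⊗ d ⊕ var v ⊗ (c ⊗ ⟦ ds ⟧)
        ≈⟨ solve 4 (λ c d v a → c :* d :+ v :* (c :* a) := c :* (d :+ v :* a))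
             ≋-refl c d (var v) ⟦ ds ⟧ ⟩
      c ⊗ (d ⊕ var v ⊗ ⟦ ds ⟧) ∎

    ⟦mul⟧ : ∀ cs ds → ⟦ mul cs ds ⟧ ≋ ⟦ cs ⟧ ⊗ ⟦ ds ⟧
    ⟦mul⟧ []       ds = ≋-sym (≋-trans (⊗-comm _ _) (zeroʳ _))
    ⟦mul⟧ (c ∷ cs) ds = begin
      ⟦ mul (c ∷ cs) ds ⟧
        ≈⟨ ⟦add⟧ (map (c ⊗_) ds) _ ⟩
      ⟦ map (c ⊗_) ds ⟧ ⊕ (con 0ℚ ⊕ var v ⊗ ⟦ mul cs ds ⟧)
        ≈⟨ ⊕-cong (⟦scale⟧ c ds) (≋-trans (⊕-zero _) (⊗-cong ≋-refl (⟦mul⟧ cs ds))) ⟩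
      c ⊗ ⟦ ds ⟧ ⊕ var v ⊗ (⟦ cs ⟧ ⊗ ⟦ ds ⟧)
        ≈⟨ solve 4 (λ c v a b → c :* b :+ v :* (a :* b) := (c :+ v :* a) :* b)
             ≋-refl c (var v) ⟦ cs ⟧ ⟦ ds ⟧ ⟩
      (c ⊕ var v ⊗ ⟦ cs ⟧) ⊗ ⟦ ds ⟧ ∎

    ⟦neg⟧ : ∀ cs → ⟦ map ⊝_ cs ⟧ ≋ ⊝ ⟦ cs ⟧
    ⟦neg⟧ []       = ≋-sym -0#≈0#
    ⟦neg⟧ (c ∷ cs) = begin
      ⊝ c ⊕ var v ⊗ ⟦ map ⊝_ cs ⟧ ≈⟨ ⊕-cong ≋-refl (⊗-cong ≋-refl (⟦neg⟧ cs)) ⟩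
      ⊝ c ⊕ var v ⊗ ⊝ ⟦ cs ⟧      ≈⟨ ⊕-cong ≋-refl (-‿distribʳ-* (var v) ⟦ cs ⟧) ⟨
      ⊝ c ⊕ ⊝ (var v ⊗ ⟦ cs ⟧)    ≈⟨ -‿+-comm c _ ⟩
      ⊝ (c ⊕ var v ⊗ ⟦ cs ⟧)      ∎

    ⟦const⟧ : ∀ p → ⟦ p ∷ [] ⟧ ≋ p
    ⟦const⟧ p = ≋-trans (⊕-cong ≋-refl (zeroʳ _)) (≋-trans (⊕-comm _ _) (⊕-zero p))

    ⟦collect⟧ : ∀ p → ⟦ collect p ⟧ ≋ p
    ⟦collect⟧ (con c) = ⟦const⟧ (con c)
    ⟦collect⟧ (var w) with w ≟ v
    ... | yes ≡.refl = ≋-trans (⊕-zero _)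
                         (≋-trans (⊗-cong ≋-refl (⟦const⟧ (con 1ℚ)))
                           (≋-trans (⊗-comm _ _) (⊗-one _)))
    ... | no  _      = ⟦const⟧ (var w)
    ⟦collect⟧ (p ⊕ q) = ≋-trans (⟦add⟧ (collect p) (collect q)) (⊕-cong (⟦collect⟧ p) (⟦collect⟧ q))
    ⟦collect⟧ (p ⊗ q) = ≋-trans (⟦mul⟧ (collect p) (collect q)) (⊗-cong (⟦collect⟧ p) (⟦collect⟧ q))
    ⟦collect⟧ (⊝ p)   = ≋-trans (⟦neg⟧ (collect p)) (⊝-cong (⟦collect⟧ p))

    module _ {S : Var → Set} where

      Over-add : ∀ {cs ds} → All (Over S) cs → All (Over S) ds → All (Over S) (add cs ds)
      Over-add []       bs       = bs
      Over-add (a ∷ as) []       = a ∷ as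
      Over-add (a ∷ as) (b ∷ bs) = (a , b) ∷ Over-add as bs

      Over-scale : ∀ {c ds} → Over S c → All (Over S) ds → All (Over S) (map (c ⊗_) ds)
      Over-scale a []       = []
      Over-scale a (b ∷ bs) = (a , b) ∷ Over-scale a bs

      Over-mul : ∀ {cs ds} → All (Over S) cs → All (Over S) ds → All (Over S) (mul cs ds)
      Over-mul []       bs = []
      Over-mul (a ∷ as) bs = Over-add (Over-scale a bs) (tt ∷ Over-mul as bs)

      Over-neg : ∀ {cs} → All (Over S) cs → All (Over S) (map ⊝_ cs)
      Over-neg []       = []
      Over-neg (a ∷ as) = a ∷ Over-neg as

    Over-collect : ∀ {vs} p → Over (_∈ v ∷ vs) p →
                   All (Over (λ w → w ≢ v × w ∈ vs)) (collect p)
    Over-collect (con c) _ = tt ∷ []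
    Over-collect (var w) s with w ≟ v
    ... | yes _ = tt ∷ tt ∷ []
    Over-collect (var w) (here w≡v)   | no w≢v = contradiction w≡v w≢v
    Over-collect (var w) (there w∈vs) | no w≢v = (w≢v , w∈vs) ∷ []
    Over-collect (p ⊕ q) (s , t) = Over-add (Over-collect p s) (Over-collect q t)
    Over-collect (p ⊗ q) (s , t) = Over-mul (Over-collect p s) (Over-collect q t)
    Over-collect (⊝ p)   s       = Over-neg (Over-collect p s)

  _[_≔_] : Point → Var → ℚ → Point
  (ρ [ v ≔ t ]) w with w ≟ v
  ... | yes _ = t
  ... | no  _ = ρ w

  ≔-same : ∀ ρ v t → (ρ [ v ≔ t ]) v ≡ t
  ≔-same ρ v t with v ≟ v
  ... | yes _   = ≡.refl
  ... | no  v≢v = contradiction ≡.refl v≢v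

  ev-fresh : ∀ {ρ v t} p → Over (_≢ v) p → ev (ρ [ v ≔ t ]) p ≡ ev ρ p
  ev-fresh (con c) _ = ≡.refl
  ev-fresh {v = v} (var w) w≢v with w ≟ v
  ... | yes w≡v = contradiction w≡v w≢v
  ... | no  _   = ≡.refl
  ev-fresh (p ⊕ q) (s , t) = cong₂ ℚ._+_ (ev-fresh p s) (ev-fresh q t)
  ev-fresh (p ⊗ q) (s , t) = cong₂ ℚ._*_ (ev-fresh p s) (ev-fresh q t)
  ev-fresh (⊝ p)   s       = cong ℚ.-_ (ev-fresh p s)

  Generic : List Var → (Point → Set) → Set
  Generic []       P = P (λ _ → 0ℚ)
  Generic (v ∷ vs) P = Generic vs (λ ρ → Eventually (λ t → P (ρ [ v ≔ t ])))

  generic-map : ∀ vs {P Q : Point → Set} → (∀ ρ → P ρ → Q ρ) → Generic vs P → Generic vs Q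
  generic-map []       f g = f _ g
  generic-map (v ∷ vs) f g = generic-map vs (λ ρ (N , h) → N , λ t N≤t → f _ (h t N≤t)) g

  generic-× : ∀ vs {P Q : Point → Set} → Generic vs P → Generic vs Q →
              Generic vs (λ ρ → P ρ × Q ρ)
  generic-× []       g h = g , h
  generic-× (v ∷ vs) g h =
    generic-map vs
      (λ ρ ((M , i) , (N , j)) → M ℚ.⊔ N , λ t M⊔N≤t →
        i t (ℚ.≤-trans (ℚ.p≤p⊔q M N) M⊔N≤t) , j t (ℚ.≤-trans (ℚ.p≤q⊔p M N) M⊔N≤t))
      (generic-× vs g h)

  generic⇒∃ : ∀ vs {P : Point → Set} → Generic vs P → ∃[ ρ ] P ρ
  generic⇒∃ []       g = _ , g
  generic⇒∃ (v ∷ vs) g with generic⇒∃ vs g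
  ... | ρ , N , h = _ , h N ℚ.≤-refl

  closed : ∀ ρ p → Over (_∈ []) p → p ≋ con (ev ρ p)
  closed ρ (con c) _       = ≋-refl
  closed ρ (var v) ()
  closed ρ (p ⊕ q) (s , t) = ≋-trans (⊕-cong (closed ρ p s) (closed ρ q t)) (≋-sym (con-⊕ _ _))
  closed ρ (p ⊗ q) (s , t) = ≋-trans (⊗-cong (closed ρ p s) (closed ρ q t)) (≋-sym (con-⊗ _ _))
  closed ρ (⊝ p)   s       = begin
    ⊝ p                            ≈⟨ ⊝-cong (closed ρ p s) ⟩
    ⊝ con c                        ≈⟨ ≋-trans (⊕-comm _ _) (⊕-zero _) ⟨
    ⊝ con c ⊕ con 0ℚ               ≡⟨ cong (λ z → ⊝ con c ⊕ con z) (ℚ.+-inverseʳ c) ⟨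
    ⊝ con c ⊕ con (c ℚ.+ ℚ.- c)    ≈⟨ ⊕-cong ≋-refl (con-⊕ _ _) ⟩
    ⊝ con c ⊕ (con c ⊕ con (ℚ.- c)) ≈⟨ ⊕-assoc _ _ _ ⟨
    (⊝ con c ⊕ con c) ⊕ con (ℚ.- c) ≈⟨ ⊕-cong (⊕-neg _) ≋-refl ⟩
    con 0ℚ ⊕ con (ℚ.- c)           ≈⟨ ⊕-zero _ ⟩
    con (ℚ.- c)                    ∎
    where c = ev ρ p

  zero⊎generic : ∀ vs p → Over (_∈ vs) p →
                 p ≋ con 0ℚ ⊎ Generic vs (λ ρ → ev ρ p ≢ 0ℚ)
  zero⊎generic [] p s with ev (λ _ → 0ℚ) p ℚ.≟ 0ℚ
  ... | yes e = inj₁ (≋-trans (closed _ p s) (subst (λ z → con (ev (λ _ → 0ℚ) p) ≋ con z) e ≋-refl))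
  ... | no ¬e = inj₂ ¬e
  zero⊎generic (v ∷ vs) p s with go (collect p) (Over-collect p s)
    where
    open Collect v
    Q : List Poly → Point → Set
    Q cs ρ = Away (λ t → ev (ρ [ v ≔ t ]) ⟦ cs ⟧)
    away-cong : ∀ {f g : ℚ → ℚ} → (∀ t → f t ≡ g t) → Away f → Away g
    away-cong e (ε , 0<ε , N , far) =
      ε , 0<ε , N , λ t N≤t → subst (λ z → ε ℚ.≤ ∣ z ∣) (e t) (far t N≤t)
    go : ∀ cs → All (Over (λ w → w ≢ v × w ∈ vs)) cs →
         ⟦ cs ⟧ ≋ con 0ℚ ⊎ Generic vs (Q cs)
    go []       []       = inj₁ ≋-refl
    go (c ∷ cs) (a ∷ as) with go cs as
    ... | inj₂ g = inj₂ (generic-map vs (λ ρ away →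
            away-cong
              (λ t → ≡.sym (cong₂ ℚ._+_ (ev-fresh c (Over-map proj₁ c a))
                              (cong (ℚ._* ev (ρ [ v ≔ t ]) ⟦ cs ⟧) (≔-same ρ v t))))
              (away-step (ev ρ c) away)) g)
    ... | inj₁ z with zero⊎generic vs c (Over-map proj₂ c a)
    ...   | inj₁ c≋0 = inj₁ (≋-trans (⊕-cong c≋0 (⊗-cong ≋-refl z))
                               (≋-trans (⊕-zero _) (zeroʳ _)))
    ...   | inj₂ g   = inj₂ (generic-map vs (λ ρ c≢0 →
              away-cong
                (λ t → ≡.trans (≡.sym (ev-fresh c (Over-map proj₁ c a)))
                         (ev-cong (ρ [ v ≔ t ])
                           (≋-sym (≋-trans (⊕-cong ≋-refl (⊗-cong ≋-refl z)) (⟦const⟧ c)))))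
                (away-const c≢0)) g)
  ... | inj₁ z = inj₁ (≋-trans (≋-sym (Collect.⟦collect⟧ v p)) z)
  ... | inj₂ g = inj₂ (generic-map vs (λ ρ away →
          let N , h = away⇒≢0 away in
          N , λ t N≤t e → h t N≤t (≡.trans (ev-cong _ (Collect.⟦collect⟧ v p)) e)) g)

  _≋0? : ∀ p → Dec (p ≋ con 0ℚ)
  p ≋0? with zero⊎generic (vars p) p (Over-vars p)
  ... | inj₁ z = yes z
  ... | inj₂ g = let ρ , evp≢0 = generic⇒∃ (vars p) g in no (evp≢0 ∘ ev-cong ρ)

  ⊗-≉0 : ∀ p q → ¬ p ≋ con 0ℚ → ¬ q ≋ con 0ℚ → ¬ p ⊗ q ≋ con 0ℚ
  ⊗-≉0 p q p≉0 q≉0 pq≋0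
    with zero⊎generic (vars p ++ vars q) p (Over-map ∈-++⁺ˡ p (Over-vars p))
       | zero⊎generic (vars p ++ vars q) q (Over-map (∈-++⁺ʳ (vars p)) q (Over-vars q))
  ... | inj₁ z | _      = p≉0 z
  ... | inj₂ _ | inj₁ z = q≉0 z
  ... | inj₂ g | inj₂ h =
    let ρ , a≢0 , b≢0 = generic⇒∃ (vars p ++ vars q) (generic-× (vars p ++ vars q) g h)
    in *-≢0 a≢0 b≢0 (ev-cong ρ pq≋0)

------------------------------------------------------------------------
-- The field of fractions of an integral domain with decidable equality

IsZero : (R : CommutativeRing 0ℓ 0ℓ) → CommutativeRing.Carrier R → Set
IsZero R x = x ≈ 0#
  where open CommutativeRing R

module FieldOfFractions
  (R : CommutativeRing 0ℓ 0ℓ)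
  (_≈0? : ∀ x → Dec (IsZero R x))
  (1≉0 : ¬ IsZero R (CommutativeRing.1# R))
  (*-≉0 : ∀ x y → ¬ IsZero R x → ¬ IsZero R y → ¬ IsZero R (CommutativeRing._*_ R x y))
  where

  open CommutativeRing R hiding (_-_; isEquivalence; refl; sym; trans)
  private
    module R = CommutativeRing R
  open import Algebra.Properties.Ring R.ring
    using (-‿distribˡ-*)
  open import Algebra.Properties.Group R.+-group
    using () renaming (x∙y⁻¹≈ε⇒x≈y to x-y≈0⇒x≈y)
  open import Algebra.Solver.Ring.NaturalCoefficients.Default R.commutativeSemiring
    using (solve; _:+_; _:*_; _:=_)
  open import Relation.Binary.Reasoning.Setoid R.setoid

  record Fraction : Set where
    constructor frac
    field
      num den : Carrier
      den≉0   : ¬ den ≈ 0#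
  open Fraction public

  infix 4 _≃_
  record _≃_ (p q : Fraction) : Set where
    constructor cross
    field
      uncross : num p * den q ≈ num q * den p
  open _≃_ public

  *-cancelʳ : ∀ {x y} z → ¬ z ≈ 0# → x * z ≈ y * z → x ≈ y
  *-cancelʳ {x} {y} z z≉0 xz≈yz = x-y≈0⇒x≈y x y (decidable-stable ((x R.- y) ≈0?) λ x-y≉0 →
    *-≉0 (x R.- y) z x-y≉0 z≉0 (begin
      (x R.- y) * z     ≈⟨ distribʳ z x (- y) ⟩
      x * z + - y * z   ≈⟨ +-cong xz≈yz (R.sym (-‿distribˡ-* y z)) ⟩
      y * z + - (y * z) ≈⟨ -‿inverseʳ (y * z) ⟩
      0#                ∎))

  fromR : Carrier → Fraction
  fromR x = frac x 1# 1≉0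

  infixl 6 _⊞_
  infixl 7 _⊠_

  _⊞_ _⊠_ : Fraction → Fraction → Fraction
  p ⊞ q = frac (num p * den q + num q * den p) (den p * den q)
            (*-≉0 (den p) (den q) (den≉0 p) (den≉0 q))
  p ⊠ q = frac (num p * num q) (den p * den q)
            (*-≉0 (den p) (den q) (den≉0 p) (den≉0 q))

  ⊟_ : Fraction → Fraction
  ⊟ p = frac (- num p) (den p) (den≉0 p)

  -- Total inverse, with inv 0 = 0.
  inv : Fraction → Fraction
  inv p with num p ≈0?
  ... | yes _     = fromR 0#
  ... | no  num≉0 = frac (den p) (num p) num≉0

  ≃-isEquivalence : IsEquivalence _≃_
  ≃-isEquivalence = record
    { refl  = cross R.refl
    ; sym   = λ (cross e) → cross (R.sym e)
    ; trans = λ {p} {q} {r} (cross e) (cross f) → cross (*-cancelʳ (den q) (den≉0 q) (begin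
        num p * den r * den q ≈⟨ solve 3 (λ a b c → a :* b :* c := a :* c :* b) R.refl _ _ _ ⟩
        num p * den q * den r ≈⟨ *-congʳ e ⟩
        num q * den p * den r ≈⟨ solve 3 (λ a b c → a :* b :* c := a :* c :* b) R.refl _ _ _ ⟩
        num q * den r * den p ≈⟨ *-congʳ f ⟩
        num r * den q * den p ≈⟨ solve 3 (λ a b c → a :* b :* c := a :* c :* b) R.refl _ _ _ ⟩
        num r * den p * den q ∎))
    }

  ⊞-cong : ∀ {p p′ q q′} → p ≃ p′ → q ≃ q′ → p ⊞ q ≃ p′ ⊞ q′
  ⊞-cong {frac a b _} {frac a′ b′ _} {frac c d _} {frac c′ d′ _} (cross e) (cross f) = cross (begin
    (a * d + c * b) * (b′ * d′)
      ≈⟨ solve 6 (λ a b c d b′ d′ → (a :* d :+ c :* b) :* (b′ :* d′)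
                   := (a :* b′) :* (d :* d′) :+ (c :* d′) :* (b :* b′)) R.refl a b c d b′ d′ ⟩
    (a * b′) * (d * d′) + (c * d′) * (b * b′)
      ≈⟨ +-cong (*-congʳ e) (*-congʳ f) ⟩
    (a′ * b) * (d * d′) + (c′ * d) * (b * b′)
      ≈⟨ solve 6 (λ a′ b′ c′ d′ b d → (a′ :* b) :* (d :* d′) :+ (c′ :* d) :* (b :* b′)
                   := (a′ :* d′ :+ c′ :* b′) :* (b :* d)) R.refl a′ b′ c′ d′ b d ⟩
    (a′ * d′ + c′ * b′) * (b * d) ∎)

  ⊠-cong : ∀ {p p′ q q′} → p ≃ p′ → q ≃ q′ → p ⊠ q ≃ p′ ⊠ q′
  ⊠-cong {frac a b _} {frac a′ b′ _} {frac c d _} {frac c′ d′ _} (cross e) (cross f) = cross (begin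
    (a * c) * (b′ * d′)   ≈⟨ solve 4 (λ a c b d → (a :* c) :* (b :* d) := (a :* b) :* (c :* d)) R.refl a c b′ d′ ⟩
    (a * b′) * (c * d′)   ≈⟨ *-cong e f ⟩
    (a′ * b) * (c′ * d)   ≈⟨ solve 4 (λ a b c d → (a :* b) :* (c :* d) := (a :* c) :* (b :* d)) R.refl a′ b c′ d ⟩
    (a′ * c′) * (b * d)   ∎)

  ⊟-cong : ∀ {p q} → p ≃ q → ⊟ p ≃ ⊟ q
  ⊟-cong {p} {q} (cross e) = cross (begin
    - num p * den q   ≈⟨ -‿distribˡ-* (num p) (den q) ⟨
    - (num p * den q) ≈⟨ -‿cong e ⟩
    - (num q * den p) ≈⟨ -‿distribˡ-* (num q) (den p) ⟩
    - num q * den p   ∎)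

  ⊞-comm : ∀ p q → p ⊞ q ≃ q ⊞ p
  ⊞-comm p q = cross (*-cong (+-comm _ _) (*-comm _ _))

  ⊠-comm : ∀ p q → p ⊠ q ≃ q ⊠ p
  ⊠-comm p q = cross (*-cong (*-comm _ _) (*-comm _ _))

  ⊞-assoc : ∀ p q r → (p ⊞ q) ⊞ r ≃ p ⊞ (q ⊞ r)
  ⊞-assoc (frac a b _) (frac c d _) (frac e f _) = cross (*-cong
    (solve 6 (λ a b c d e f → (a :* d :+ c :* b) :* f :+ e :* (b :* d)
               := a :* (d :* f) :+ (c :* f :+ e :* d) :* b) R.refl a b c d e f)
    (R.sym (*-assoc b d f)))

  ⊠-assoc : ∀ p q r → (p ⊠ q) ⊠ r ≃ p ⊠ (q ⊠ r)
  ⊠-assoc p q r = cross (*-cong (*-assoc _ _ _) (R.sym (*-assoc _ _ _)))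

  ⊞-identityˡ : ∀ p → fromR 0# ⊞ p ≃ p
  ⊞-identityˡ (frac a b _) = cross (begin
    (0# * b + a * 1#) * b ≈⟨ *-congʳ (+-cong (zeroˡ b) (*-identityʳ a)) ⟩
    (0# + a) * b          ≈⟨ *-cong (+-identityˡ a) (R.sym (*-identityˡ b)) ⟩
    a * (1# * b)          ∎)

  ⊠-identityˡ : ∀ p → fromR 1# ⊠ p ≃ p
  ⊠-identityˡ (frac a b _) = cross (*-cong (*-identityˡ a) (R.sym (*-identityˡ b)))

  num≈0⇒≃0 : ∀ {p} → num p ≈ 0# → p ≃ fromR 0#
  num≈0⇒≃0 {p} e = cross (R.trans (*-identityʳ _) (R.trans e (R.sym (zeroˡ (den p)))))

  ≃0⇒num≈0 : ∀ {p} → p ≃ fromR 0# → num p ≈ 0#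
  ≃0⇒num≈0 {p} (cross e) = R.trans (R.sym (*-identityʳ _)) (R.trans e (zeroˡ (den p)))

  ⊞-inverseˡ : ∀ p → ⊟ p ⊞ p ≃ fromR 0#
  ⊞-inverseˡ (frac a b _) = num≈0⇒≃0 (begin
    - a * b + a * b   ≈⟨ +-congʳ (-‿distribˡ-* a b) ⟨
    - (a * b) + a * b ≈⟨ -‿inverseˡ (a * b) ⟩
    0#                ∎)

  ⊠-distribˡ-⊞ : ∀ p q r → p ⊠ (q ⊞ r) ≃ p ⊠ q ⊞ p ⊠ r
  ⊠-distribˡ-⊞ (frac a b _) (frac c d _) (frac e f _) = cross
    (solve 6 (λ a b c d e f → (a :* (c :* f :+ e :* d)) :* ((b :* d) :* (b :* f))
               := ((a :* c) :* (b :* f) :+ (a :* e) :* (b :* d)) :* (b :* (d :* f)))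
      R.refl a b c d e f)

  private
    module E = IsEquivalence ≃-isEquivalence

  fractionRing : CommutativeRing 0ℓ 0ℓ
  fractionRing = record
    { Carrier = Fraction ; _≈_ = _≃_ ; _+_ = _⊞_ ; _*_ = _⊠_ ; -_ = ⊟_
    ; 0# = fromR 0# ; 1# = fromR 1#
    ; isCommutativeRing = record
      { isRing = record
        { +-isAbelianGroup = record
          { isGroup = record
            { isMonoid = record
              { isSemigroup = record
                { isMagma = record { isEquivalence = ≃-isEquivalence ; ∙-cong = ⊞-cong }
                ; assoc = ⊞-assoc }
              ; identity = ⊞-identityˡ , λ p → E.trans (⊞-comm p (fromR 0#)) (⊞-identityˡ p) }
            ; inverse = ⊞-inverseˡ , λ p → E.trans (⊞-comm p (⊟ p)) (⊞-inverseˡ p)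
            ; ⁻¹-cong = ⊟-cong }
          ; comm = ⊞-comm }
        ; *-cong = ⊠-cong
        ; *-assoc = ⊠-assoc
        ; *-identity = ⊠-identityˡ , λ p → E.trans (⊠-comm p (fromR 1#)) (⊠-identityˡ p)
        ; distrib = ⊠-distribˡ-⊞
                  , λ p q r → E.trans (⊠-comm (q ⊞ r) p)
                      (E.trans (⊠-distribˡ-⊞ p q r) (⊞-cong (⊠-comm p q) (⊠-comm p r)))
        }
      ; *-comm = ⊠-comm } }

  _≃?_ : Decidable _≃_
  p ≃? q = map′ (λ e → cross (x-y≈0⇒x≈y _ _ e))
                (λ (cross e) → R.trans (+-congʳ e) (-‿inverseʳ _))
                ((num p * den q R.- num q * den p) ≈0?)

  inv-inverseʳ : ∀ p → ¬ p ≃ fromR 0# → p ⊠ inv p ≃ fromR 1#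
  inv-inverseʳ p p≄0 with num p ≈0?
  ... | yes num≈0 = contradiction (num≈0⇒≃0 num≈0) p≄0
  ... | no  _     = cross (begin
    num p * den p * 1#   ≈⟨ *-identityʳ _ ⟩
    num p * den p        ≈⟨ *-comm _ _ ⟩
    den p * num p        ≈⟨ *-identityˡ _ ⟨
    1# * (den p * num p) ∎)

  inv-zero : ∀ p → p ≃ fromR 0# → inv p ≃ fromR 0#
  inv-zero p p≃0 with num p ≈0?
  ... | yes _     = E.refl
  ... | no  num≉0 = contradiction (≃0⇒num≈0 p≃0) num≉0

  inv-cong : ∀ {p q} → p ≃ q → inv p ≃ inv q
  inv-cong {p} {q} p≃q with num p ≈0? | num q ≈0?
  ... | yes _ | yes _ = E.refl
  ... | yes z | no n  = contradiction (≃0⇒num≈0 (E.trans (E.sym p≃q) (num≈0⇒≃0 z))) n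
  ... | no n  | yes z = contradiction (≃0⇒num≈0 (E.trans p≃q (num≈0⇒≃0 z))) n
  ... | no _  | no _  = cross (R.trans (*-comm _ _) (R.trans (R.sym (uncross p≃q)) (*-comm _ _)))

  open import Algebra.Properties.Group (CommutativeRing.+-group fractionRing)
    using () renaming (x∙y⁻¹≈ε⇒x≈y to ⊟≃0⇒≃)

  fractionField : HeytingField 0ℓ 0ℓ 0ℓ
  fractionField = record
    { Carrier = Fraction ; _≈_ = _≃_ ; _#_ = λ p q → ¬ p ≃ q
    ; _+_ = _⊞_ ; _*_ = _⊠_ ; -_ = ⊟_ ; 0# = fromR 0# ; 1# = fromR 1#
    ; isHeytingField = record
      { isHeytingCommutativeRing = record
        { isCommutativeRing = F.isCommutativeRing
        ; isApartnessRelation = DecSetoidProperties.≉-isApartnessRelation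
            (record { isDecEquivalence = record { isEquivalence = ≃-isEquivalence ; _≟_ = _≃?_ } })
        ; #⇒invertible = λ {p} {q} p≄q →
            let i = inv-inverseʳ (p F.- q) (p≄q ∘ ⊟≃0⇒≃ p q)
            in inv (p F.- q) , E.trans (⊠-comm (inv (p F.- q)) (p F.- q)) i , i
        ; invertible⇒# = λ {p} {q} (r , _ , inverse) p≃q → 1≉0 (≃0⇒num≈0 (E.trans (E.sym inverse)
            (E.trans (⊠-cong {q = r} (E.trans (⊞-cong {q = ⊟ q} p≃q E.refl) (F.-‿inverseʳ q)) E.refl) (F.zeroˡ r))))
        }
      ; tight = λ p q → decidable-stable (p ≃? q) , λ p≃q p≄q → p≄q p≃q
      } }
    where module F = CommutativeRing fractionRing

------------------------------------------------------------------------
-- The field ℚ(x₁, x₂, …, y₁, y₂, …)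

-- X i and Y i are the indeterminates x_{i+1} and y_{i+1}.
data Indeterminate : Set where
  X Y : ℕ → Indeterminate

_≟ᵢ_ : DecidableEquality Indeterminate
X i ≟ᵢ X j = map′ (cong X) (λ { ≡.refl → ≡.refl }) (i ℕ.≟ j)
X i ≟ᵢ Y j = no λ ()
Y i ≟ᵢ X j = no λ ()
Y i ≟ᵢ Y j = map′ (cong Y) (λ { ≡.refl → ≡.refl }) (i ℕ.≟ j)

open Polynomials Indeterminate _≟ᵢ_ public
open FieldOfFractions polyRing _≋0? 1≉0 ⊗-≉0 public

open HeytingField fractionField public
  using (_≈_; _+_; _*_; -_; _-_; 0#; 1#)
open import Algebra.Properties.Monoid.Sum
  (CommutativeRing.+-monoid fractionRing) public using (sum; sum-syntax)

infix  4 _≉_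
infixl 7 _/_

_≉_ : Fraction → Fraction → Set
p ≉ q = ¬ p ≈ q

_/_ : Fraction → Fraction → Fraction
p / q = p * inv q

x : ℕ → Fraction
x zero    = 1#
x (suc i) = fromR (var (X i))

y : ℕ → Fraction
y zero    = 1#
y (suc i) = fromR (var (Y i))

fromVar≉0 : ∀ v → fromR (var v) ≉ 0#
fromVar≉0 v e with ev-cong (λ _ → 1ℚ) (≃0⇒num≈0 e)
... | ()

x≉0 : ∀ k → x k ≉ 0#
x≉0 zero    e = 1≉0 (≃0⇒num≈0 e)
x≉0 (suc i) e = fromVar≉0 (X i) e

y≉0 : ∀ k → y k ≉ 0#
y≉0 zero    e = 1≉0 (≃0⇒num≈0 e)
y≉0 (suc i) e = fromVar≉0 (Y i) e

θ : (ℕ → Fraction) → ℕ → Fraction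
θ u k = u (suc k) / u k

θ² : (ℕ → Fraction) → ℕ → Fraction
θ² u = θ (θ u)

-- contFrac a b j m = a j / (b j + a (j+1) / (b (j+1) + ⋯ + a (j+m-1) / b (j+m-1)))
contFrac : (a b : ℕ → Fraction) → ℕ → ℕ → Fraction
contFrac a b j zero    = 0#
contFrac a b j (suc m) = a j / (b j + contFrac a b (suc j) m)

-- No denominator occurring in contFrac a b j m vanishes, so its value does
-- not depend on the convention inv 0 = 0.
WellDefined : (a b : ℕ → Fraction) → ℕ → ℕ → Set
WellDefined a b j zero    = ⊤
WellDefined a b j (suc m) = b j + contFrac a b (suc j) m ≉ 0# × WellDefined a b (suc j) m

{-# OPTIONS --safe #-}
module Submission where

-- Put s k = y k / x k, S k for the sum of s i over k ≤ i ≤ n, and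
-- Δ k = s (k+1) S (k+1) − s k S (k+2). By descending induction on k the tail of
-- the continued fraction starting at a (2k+3) equals y k S (k+2) / Δ k: the
-- denominators under it are b (2k+4) + ⋯ = x (k+1) s (k+2) S (k+2) / Δ (k+1) and
-- b (2k+3) + ⋯ = y (k+2) Δ k / (y (k+1)² S (k+2)), and at the top b 1 + ⋯ = y 1 / S 1.
-- No denominator vanishes, because S k and Δ k are nonzero: when all
-- indeterminates are 1, S k is a positive integer and Δ k is 1.

open import Algebra using (CommutativeRing)
open import Data.Nat using (ℕ; zero; suc; _≤_; s≤s) renaming (_+_ to _+ℕ_; _*_ to _*ℕ_)
open import Data.Product using (_×_; _,_; proj₁; proj₂; ∃-syntax)
open import Level using (0ℓ)
open import Relation.Nullary using (¬_)

-- Division in a commutative ring whose nonzero elements have inverses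

module InverseAlgebra
  (F : CommutativeRing 0ℓ 0ℓ)
  (inv : CommutativeRing.Carrier F → CommutativeRing.Carrier F)
  (inverseʳ : ∀ p → ¬ CommutativeRing._≈_ F p (CommutativeRing.0# F) →
              CommutativeRing._≈_ F (CommutativeRing._*_ F p (inv p)) (CommutativeRing.1# F))
  where

  open CommutativeRing F hiding (_-_)
  open import Algebra.Definitions _≈_ using (AlmostRightCancellative)
  open import Algebra.Properties.AbelianGroup +-abelianGroup using (∙-cancelʳ)
  open import Algebra.Solver.Ring.NaturalCoefficients.Default commutativeSemiring
    using (solve; _:+_; _:*_; _:=_)
  open import Relation.Binary.Reasoning.Setoid setoid

  infixl 7 _/_

  _/_ : Carrier → Carrier → Carrier
  p / q = p * inv q

  /-* : ∀ p {q} → q ≉ 0# → p / q * q ≈ p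
  /-* p {q} q≉0 = begin
    p * inv q * q   ≈⟨ *-assoc p (inv q) q ⟩
    p * (inv q * q) ≈⟨ *-congˡ (trans (*-comm (inv q) q) (inverseʳ q q≉0)) ⟩
    p * 1#          ≈⟨ *-identityʳ p ⟩
    p               ∎

  *-/ : ∀ p {q} → q ≉ 0# → p * q / q ≈ p
  *-/ p {q} q≉0 = begin
    p * q * inv q   ≈⟨ *-assoc p q (inv q) ⟩
    p * (q * inv q) ≈⟨ *-congˡ (inverseʳ q q≉0) ⟩
    p * 1#          ≈⟨ *-identityʳ p ⟩
    p               ∎

  *-cancelʳ-≉0 : AlmostRightCancellative 0# _*_
  *-cancelʳ-≉0 r p q r≉0 pr≈qr = begin
    p         ≈⟨ *-/ p r≉0 ⟨
    p * r / r ≈⟨ *-congʳ pr≈qr ⟩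
    q * r / r ≈⟨ *-/ q r≉0 ⟩
    q         ∎

  *≈⇒≈/ : ∀ {p q r} → q ≉ 0# → p * q ≈ r → p ≈ r / q
  *≈⇒≈/ {p} {q} {r} q≉0 pq≈r = *-cancelʳ-≉0 q p (r / q) q≉0 (trans pq≈r (sym (/-* r q≉0)))

  *-≉0 : ∀ {p q} → p ≉ 0# → q ≉ 0# → p * q ≉ 0#
  *-≉0 {p} {q} p≉0 q≉0 pq≈0 = p≉0 (*-cancelʳ-≉0 q p 0# q≉0 (trans pq≈0 (sym (zeroˡ q))))

  -- How each denominator is shown not to vanish: multiplied by a suitable factor it has a known
  -- nonzero value.
  *≈⇒≉0 : ∀ {p q r} → p * q ≈ r → r ≉ 0# → p ≉ 0#
  *≈⇒≉0 {p} {q} pq≈r r≉0 p≈0 = r≉0 (trans (sym pq≈r) (trans (*-congʳ p≈0) (zeroˡ q)))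

  /-≉0 : ∀ {p q} → p ≉ 0# → q ≉ 0# → p / q ≉ 0#
  /-≉0 {p} p≉0 q≉0 = *≈⇒≉0 (/-* p q≉0) p≉0

  -+ : ∀ p q → p + - q + q ≈ p
  -+ p q = trans (+-assoc p (- q) q) (trans (+-congˡ (-‿inverseˡ q)) (+-identityʳ p))

  -- Clears the denominators of `θ²`: `p`, `q`, `r` will be consecutive terms, the latest first.
  /-/-* : ∀ p q r → q ≉ 0# → r ≉ 0# → (p / q) / (q / r) * (q * q) ≈ p * r
  /-/-* p q r q≉0 r≉0 = begin
    (p / q) / (q / r) * (q * q)           ≈⟨ *-congˡ (*-congʳ (/-* q r≉0)) ⟨
    (p / q) / (q / r) * (q / r * r * q)
      ≈⟨ solve 4 (λ A B r q → A :* (B :* r :* q) := A :* B :* q :* r) refl _ (q / r) r q ⟩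
    (p / q) / (q / r) * (q / r) * q * r   ≈⟨ *-congʳ (*-congʳ (/-* (p / q) (/-≉0 q≉0 r≉0))) ⟩
    p / q * q * r                         ≈⟨ *-congʳ (/-* p q≉0) ⟩
    p * r                                 ∎

  -- Identities linking consecutive tails, cleared of denominators

  -- `q`, `v`, `t` will be x, y, s at k and `z` will be s (k+1); `R` and `R′` are the sums from k+1
  -- and k+2, and `E` is Δ k. Writing `v` as `t * q` makes the defining relation of Δ k appear.
  odd-step : ∀ {q v t z R R′ E T} → t * q ≈ v → E + t * R′ ≈ z * R →
             T * E ≈ v * R′ → (q + T) * E ≈ q * (z * R)
  odd-step {q} {v} {t} {z} {R} {R′} {E} {T} tq≈v E+tR′≈zR TE≈vR′ = begin
    (q + T) * E            ≈⟨ distribʳ E q T ⟩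
    q * E + T * E          ≈⟨ +-congˡ (trans TE≈vR′ (*-congʳ (sym tq≈v))) ⟩
    q * E + t * q * R′
      ≈⟨ solve 4 (λ q E t R′ → q :* E :+ t :* q :* R′ := q :* (E :+ t :* R′)) refl q E t R′ ⟩
    q * (E + t * R′)       ≈⟨ *-congˡ E+tR′≈zR ⟩
    q * (z * R)            ∎

  -- `W` is the quotient of `a` by `N`, whose value comes from `odd-step`. The factor `z` divides
  -- both `N * E` and `w`, so it cancels.
  quotient-step : ∀ {q v w r z R E N W a} → z ≉ 0# → N * E ≈ q * (z * R) →
                  a * v ≈ w → z * r ≈ w → W * N ≈ a → W * v * q * R ≈ r * E
  quotient-step {q} {v} {w} {r} {z} {R} {E} {N} {W} {a} z≉0 NE≈qzR av≈w zr≈w WN≈a =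
    *-cancelʳ-≉0 z _ _ z≉0 (begin
      W * v * q * R * z
        ≈⟨ solve 5 (λ W v q R z → W :* v :* q :* R :* z := W :* v :* (q :* (z :* R))) refl W v q R z ⟩
      W * v * (q * (z * R)) ≈⟨ *-congˡ NE≈qzR ⟨
      W * v * (N * E)
        ≈⟨ solve 4 (λ W v N E → W :* v :* (N :* E) := W :* N :* v :* E) refl W v N E ⟩
      W * N * v * E         ≈⟨ *-congʳ (trans (*-congʳ WN≈a) av≈w) ⟩
      w * E                 ≈⟨ *-congʳ zr≈w ⟨
      z * r * E             ≈⟨ solve 3 (λ z r E → z :* r :* E := r :* E :* z) refl z r E ⟩
      r * E * z             ∎)

  -- The triples `p u s`, `q v t`, `r w z` are x, y, s at k, k+1, k+2; `D` and `E` are Δ k and Δ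
  -- (k+1); `A` and `C` are θ² of y and of x.
  even-step : ∀ {p q r u v w s t z R R′ D E A C b W} → p ≉ 0# →
    s * p ≈ u → t * q ≈ v → z * r ≈ w →
    R ≈ z + R′ → D + s * R ≈ t * (t + R) → E + t * R′ ≈ z * R →
    C * (q * q) ≈ r * p → A * (v * v) ≈ w * u → b * p + A ≈ C →
    W * v * q * R ≈ r * E →
    (b + W) * (v * v * R) ≈ w * D
  even-step {p} {q} {r} {u} {v} {w} {s} {t} {z} {R} {R′} {D} {E} {A} {C} {b} {W}
    p≉0 sp≈u tq≈v zr≈w R≈z+R′ D+sR E+tR′ Cqq Avv bp+A Wvq =
    -- The added terms complete `D` and `E` to their defining relations, so no subtraction occurs.
    ∙-cancelʳ (w * s * R + t * r * t * R′) _ _ (begin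
      (b + W) * (v * v * R) + (w * s * R + t * r * t * R′)
        ≈⟨ +-congʳ (*-congˡ (*-congʳ (*-congˡ tq≈v))) ⟨
      (b + W) * (v * (t * q) * R) + (w * s * R + t * r * t * R′)
        ≈⟨ solve 10 (λ b W v t q R w s r R′ →
             (b :+ W) :* (v :* (t :* q) :* R) :+ (w :* s :* R :+ t :* r :* t :* R′)
             := (b :* (v :* (t :* q)) :+ w :* s) :* R :+ (t :* (W :* v :* q :* R) :+ t :* r :* t :* R′))
             refl b W v t q R w s r R′ ⟩
      (b * (v * (t * q)) + w * s) * R + (t * (W * v * q * R) + t * r * t * R′)
        ≈⟨ +-cong (*-congʳ (trans (+-congʳ (*-congˡ (*-congˡ tq≈v))) bvv+ws)) (+-congʳ (*-congˡ Wvq)) ⟩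
      t * t * r * R + (t * (r * E) + t * r * t * R′)
        ≈⟨ solve 5 (λ t r R E R′ → t :* t :* r :* R :+ (t :* (r :* E) :+ t :* r :* t :* R′)
             := t :* t :* r :* R :+ t :* r :* (E :+ t :* R′)) refl t r R E R′ ⟩
      t * t * r * R + t * r * (E + t * R′)
        ≈⟨ +-cong (*-congˡ R≈z+R′) (*-congˡ E+tR′) ⟩
      t * t * r * (z + R′) + t * r * (z * R)
        ≈⟨ solve 5 (λ t r z R R′ → t :* t :* r :* (z :+ R′) :+ t :* r :* (z :* R)
             := z :* r :* (t :* (t :+ R)) :+ t :* r :* t :* R′) refl t r z R R′ ⟩
      z * r * (t * (t + R)) + t * r * t * R′
        ≈⟨ +-congʳ (*-cong zr≈w (sym D+sR)) ⟩
      w * (D + s * R) + t * r * t * R′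
        ≈⟨ solve 5 (λ w D s R X → w :* (D :+ s :* R) :+ X
             := w :* D :+ (w :* s :* R :+ X)) refl w D s R (t * r * t * R′) ⟩
      w * D + (w * s * R + t * r * t * R′) ∎)
    where
    -- After multiplication by `p`, the term `w * s * p` is `A * (v * v)`; it restores what `b * p`
    -- lacks from `C`, so that θ² of y drops out.
    bvv+ws : b * (v * v) + w * s ≈ t * t * r
    bvv+ws = *-cancelʳ-≉0 p _ _ p≉0 (begin
      (b * (v * v) + w * s) * p
        ≈⟨ solve 5 (λ b v w s p → (b :* (v :* v) :+ w :* s) :* p
             := b :* p :* (v :* v) :+ w :* (s :* p)) refl b v w s p ⟩
      b * p * (v * v) + w * (s * p) ≈⟨ +-congˡ (trans (*-congˡ sp≈u) (sym Avv)) ⟩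
      b * p * (v * v) + A * (v * v) ≈⟨ distribʳ (v * v) (b * p) A ⟨
      (b * p + A) * (v * v)         ≈⟨ *-cong bp+A (*-cong (sym tq≈v) (sym tq≈v)) ⟩
      C * (t * q * (t * q))
        ≈⟨ solve 3 (λ C t q → C :* (t :* q :* (t :* q)) := t :* t :* (C :* (q :* q))) refl C t q ⟩
      t * t * (C * (q * q))         ≈⟨ *-congˡ Cqq ⟩
      t * t * (r * p)               ≈⟨ *-assoc (t * t) r p ⟨
      t * t * r * p                 ∎)

  -- `T` is the quotient of `A` by the denominator `V` evaluated in `even-step`; the common factor
  -- `w` cancels.
  tail-step : ∀ {u v w R D A T V} → w ≉ 0# → A * (v * v) ≈ w * u →
              V * (v * v * R) ≈ w * D → T * V ≈ A → T * D ≈ u * R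
  tail-step {u} {v} {w} {R} {D} {A} {T} {V} w≉0 Avv≈wu VvvR≈wD TV≈A =
    *-cancelʳ-≉0 w _ _ w≉0 (begin
      T * D * w             ≈⟨ solve 3 (λ T D w → T :* D :* w := T :* (w :* D)) refl T D w ⟩
      T * (w * D)           ≈⟨ *-congˡ VvvR≈wD ⟨
      T * (V * (v * v * R))
        ≈⟨ solve 4 (λ T V v R → T :* (V :* (v :* v :* R)) := T :* V :* (v :* v) :* R) refl T V v R ⟩
      T * V * (v * v) * R   ≈⟨ *-congʳ (trans (*-congʳ TV≈A) Avv≈wu) ⟩
      w * u * R             ≈⟨ solve 3 (λ w u R → w :* u :* R := u :* R :* w) refl w u R ⟩
      u * R * w             ∎)

  -- The top level has its own form of `b`, and s 0 = 1 removes the factor of `R′` in the relation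
  -- for Δ 0.
  head-step : ∀ {x₁ y₁ s R R′ D b W} → s * x₁ ≈ y₁ → R ≈ s + R′ → D + R′ ≈ s * R →
              b + y₁ ≈ x₁ → W * R ≈ x₁ * D → (b + W) * R ≈ y₁
  head-step {x₁} {y₁} {s} {R} {R′} {D} {b} {W} sx≈y R≈s+R′ D+R′≈sR b+y≈x WR≈xD =
    ∙-cancelʳ (y₁ * R + x₁ * R′) _ _ (begin
      (b + W) * R + (y₁ * R + x₁ * R′)
        ≈⟨ solve 6 (λ b W R y₁ x₁ R′ → (b :+ W) :* R :+ (y₁ :* R :+ x₁ :* R′)
             := (b :+ y₁) :* R :+ (W :* R :+ x₁ :* R′)) refl b W R y₁ x₁ R′ ⟩
      (b + y₁) * R + (W * R + x₁ * R′)
        ≈⟨ +-cong (*-cong b+y≈x R≈s+R′) (+-congʳ WR≈xD) ⟩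
      x₁ * (s + R′) + (x₁ * D + x₁ * R′)
        ≈⟨ solve 4 (λ x₁ s R′ D → x₁ :* (s :+ R′) :+ (x₁ :* D :+ x₁ :* R′)
             := s :* x₁ :+ (x₁ :* (D :+ R′) :+ x₁ :* R′)) refl x₁ s R′ D ⟩
      s * x₁ + (x₁ * (D + R′) + x₁ * R′)
        ≈⟨ +-cong sx≈y (+-congʳ (*-congˡ D+R′≈sR)) ⟩
      y₁ + (x₁ * (s * R) + x₁ * R′)
        ≈⟨ solve 5 (λ y₁ x₁ s R R′ → y₁ :+ (x₁ :* (s :* R) :+ x₁ :* R′)
             := y₁ :+ (s :* x₁ :* R :+ x₁ :* R′)) refl y₁ x₁ s R R′ ⟩
      y₁ + (s * x₁ * R + x₁ * R′) ≈⟨ +-congˡ (+-congʳ (*-congʳ sx≈y)) ⟩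
      y₁ + (y₁ * R + x₁ * R′) ∎)

  -- Values of the tails

  module Tails
    (x y : ℕ → Carrier) (x≉0 : ∀ k → x k ≉ 0#) (y≉0 : ∀ k → y k ≉ 0#) where

    s : ℕ → Carrier
    s k = y k / x k

    -- The second argument counts summands, in place of the fixed upper limit n.
    S : ℕ → ℕ → Carrier
    S k zero    = 0#
    S k (suc m) = s k + S (suc k) m

    -- Both sums end at index 1 + k + m, hence the extra summand in the one that starts earlier.
    Δ : ℕ → ℕ → Carrier
    Δ k m = s (1 +ℕ k) * S (1 +ℕ k) (suc m) + - (s k * S (2 +ℕ k) m)

    s*x : ∀ k → s k * x k ≈ y k
    s*x k = /-* (y k) (x≉0 k)

    Δ-+ : ∀ k m → Δ k m + s k * S (2 +ℕ k) m ≈ s (1 +ℕ k) * S (1 +ℕ k) (suc m)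
    Δ-+ k m = -+ _ _

    -- T is the tail starting at a (2k + 3) and comprising m pairs of partial quotients.
    TailValue : ℕ → ℕ → Carrier → Set
    TailValue k m T = T * Δ k m ≈ y k * S (2 +ℕ k) m

    tailValue-zero : ∀ k → TailValue k 0 0#
    tailValue-zero k = trans (zeroˡ (Δ k 0)) (sym (zeroʳ (y k)))

    module _ (S≉0 : ∀ k m → S k (suc m) ≉ 0#) (Δ≉0 : ∀ k m → Δ k m ≉ 0#) where

      b+T-value : ∀ {k m b T} → b ≈ x k → TailValue k m T →
                  (b + T) * Δ k m ≈ x k * (s (1 +ℕ k) * S (1 +ℕ k) (suc m))
      b+T-value {k} {m} b≈x TΔ≈yS =
        trans (*-congʳ (+-congʳ b≈x)) (odd-step (s*x k) (Δ-+ k m) TΔ≈yS)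

      b+T≉0 : ∀ {k m b T} → b ≈ x k → TailValue k m T → b + T ≉ 0#
      b+T≉0 {k} {m} b≈x T-value = *≈⇒≉0 (b+T-value {k} {m} b≈x T-value)
        (*-≉0 (x≉0 k) (*-≉0 (/-≉0 (y≉0 (1 +ℕ k)) (x≉0 (1 +ℕ k))) (S≉0 (1 +ℕ k) m)))

      -- `W` is the tail starting at a (2k+2), one level above `T`.
      a/b+T-value : ∀ {k m a b T W} → a ≈ y (1 +ℕ k) / y k → b ≈ x k → W ≈ a / (b + T) →
                    TailValue k m T → W * y k * x k * S (1 +ℕ k) (suc m) ≈ x (1 +ℕ k) * Δ k m
      a/b+T-value {k} {m} {a} a≈θy b≈x W≈a/b+T T-value =
        quotient-step (/-≉0 (y≉0 (1 +ℕ k)) (x≉0 (1 +ℕ k))) (b+T-value {k} {m} b≈x T-value)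
          (trans (*-congʳ a≈θy) (/-* (y (1 +ℕ k)) (y≉0 k))) (s*x (1 +ℕ k))
          (trans (*-congʳ W≈a/b+T) (/-* a (b+T≉0 {k} {m} b≈x T-value)))

      -- The induction step strips two levels: `a`, `b` have index 2k+3, `a′`, `b′` index 2k+4, and
      -- `T′` is the tail from a (2k+5).
      tailValue-suc : ∀ {k m a b a′ b′ T W T′} →
        a ≈ (y (2 +ℕ k) / y (1 +ℕ k)) / (y (1 +ℕ k) / y k) →
        b ≈ ((x (2 +ℕ k) / x (1 +ℕ k)) / (x (1 +ℕ k) / x k)
              + - ((y (2 +ℕ k) / y (1 +ℕ k)) / (y (1 +ℕ k) / y k))) / x k →
        a′ ≈ y (2 +ℕ k) / y (1 +ℕ k) → b′ ≈ x (1 +ℕ k) →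
        T ≈ a / (b + W) → W ≈ a′ / (b′ + T′) → TailValue (1 +ℕ k) m T′ →
        b + W ≉ 0# × TailValue k (suc m) T
      tailValue-suc {k} {m} {a} {b} {W = W} a≈ b≈ a′≈ b′≈ T≈ W≈ T′-value =
        V≉0 , tail-step (y≉0 (2 +ℕ k)) θ²y*yy V*yyS
                (trans (*-congʳ T≈) (trans (/-* a V≉0) a≈))
        where
        θ²y*yy = /-/-* (y (2 +ℕ k)) (y (1 +ℕ k)) (y k) (y≉0 (1 +ℕ k)) (y≉0 k)
        V*yyS : (b + W) * (y (1 +ℕ k) * y (1 +ℕ k) * S (2 +ℕ k) (suc m)) ≈ y (2 +ℕ k) * Δ k (suc m)
        V*yyS = even-step (x≉0 k) (s*x k) (s*x (1 +ℕ k)) (s*x (2 +ℕ k)) refl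
          (Δ-+ k (suc m)) (Δ-+ (1 +ℕ k) m)
          (/-/-* (x (2 +ℕ k)) (x (1 +ℕ k)) (x k) (x≉0 (1 +ℕ k)) (x≉0 k)) θ²y*yy
          (trans (+-congʳ (trans (*-congʳ b≈) (/-* _ (x≉0 k)))) (-+ _ _))
          (a/b+T-value {1 +ℕ k} {m} a′≈ b′≈ W≈ T′-value)
        V≉0 : b + W ≉ 0#
        V≉0 = *≈⇒≉0 V*yyS (*-≉0 (y≉0 (2 +ℕ k)) (Δ≉0 k (suc m)))

      head-value : ∀ {m a b a′ b′ W T} → x 0 ≈ 1# → y 0 ≈ 1# →
        a ≈ y 1 → b ≈ x 1 + - y 1 → a′ ≈ y 1 / y 0 → b′ ≈ x 0 →
        W ≈ a′ / (b′ + T) → TailValue 0 m T →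
        b + W ≉ 0# × S 1 (suc m) ≈ a / (b + W)
      head-value {m} {a} {b} {W = W} x₀≈1 y₀≈1 a≈ b≈ a′≈ b′≈ W≈ T-value =
        V≉0 , *≈⇒≈/ V≉0 (trans (*-comm _ _) (trans V*S (sym a≈)))
        where
        s₀≈1 : s 0 ≈ 1#
        s₀≈1 = trans (sym (*-identityʳ (s 0))) (trans (*-congˡ (sym x₀≈1)) (trans (s*x 0) y₀≈1))
        W*S : W * S 1 (suc m) ≈ x 1 * Δ 0 m
        W*S = trans
          (*-congʳ (sym (trans (*-cong (trans (*-congˡ y₀≈1) (*-identityʳ W)) x₀≈1) (*-identityʳ W))))
          (a/b+T-value {0} {m} a′≈ b′≈ W≈ T-value)
        V*S : (b + W) * S 1 (suc m) ≈ y 1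
        V*S = head-step (s*x 1) refl
          (trans (+-congˡ (sym (trans (*-congʳ s₀≈1) (*-identityˡ _)))) (Δ-+ 0 m))
          (trans (+-congʳ b≈) (-+ (x 1) (y 1))) W*S
        V≉0 : b + W ≉ 0#
        V≉0 = *≈⇒≉0 V*S (y≉0 1)

-- The expansion of `contFrac` over the field of fractions

open import Defs
open import Data.Fin using (toℕ)
import Data.Nat.Properties as ℕ
open import Data.Rational as ℚ using (ℚ; 0ℚ; 1ℚ)
import Data.Rational.Properties as ℚ
import Data.Rational.Solver as ℚSolver
open import Data.Unit using (tt)
open import Relation.Nullary using (yes; no; contradiction)
open import Relation.Binary.PropositionalEquality as ≡ using (_≡_; _≢_; cong; subst)

open import Algebra.Properties.Monoid.Sum (CommutativeRing.+-monoid fractionRing)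
  using (sum-cong-≗)

module K = CommutativeRing fractionRing
open InverseAlgebra fractionRing inv inv-inverseʳ using (module Tails)

-- This and the next equations restate `contFrac`, `θ²` and division with the operations of
-- `fractionRing`, the form in which `Tails` takes them.
contFrac-suc : ∀ a b j m →
               contFrac a b j (suc m) K.≈ a j K.* inv (b j K.+ contFrac a b (suc j) m)
contFrac-suc a b j m = K.refl

θ²′ : (ℕ → Fraction) → ℕ → Fraction
θ²′ u k = (u (2 +ℕ k) K.* inv (u (1 +ℕ k))) K.* inv (u (1 +ℕ k) K.* inv (u k))

θ²-quotient : ∀ u k → θ² u k ≡ θ²′ u k
θ²-quotient u k = ≡.refl

minus-div : ∀ p q r → (p - q) / r ≡ (p K.+ K.- q) K.* inv r
minus-div p q r = ≡.refl

-- Stated for arbitrary sequences in place of x and y, whose inverses would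
-- otherwise be computed during conversion checking.
module Expansion (u v : ℕ → Fraction) (u≉0 : ∀ k → u k ≉ 0#) (v≉0 : ∀ k → v k ≉ 0#) where

  open Tails u v u≉0 v≉0

  S-sum : ∀ k m → ∑[ i < m ] s (k +ℕ toℕ i) ≡ S k m
  S-sum k zero    = ≡.refl
  S-sum k (suc m) = ≡.cong₂ _+_ (cong s (ℕ.+-identityʳ k))
    (≡.trans (sum-cong-≗ {m} (λ i → cong s (ℕ.+-suc k (toℕ i)))) (S-sum (suc k) m))

  -- Well-definedness travels with the value, since the values show the denominators nonzero. In use
  -- j = 2k+3 and l = 2m; as separate arguments they can be rewritten independently.
  Tail : (a b : ℕ → Fraction) → ℕ → ℕ → ℕ → ℕ → Set
  Tail a b k m j l = WellDefined a b j l × TailValue k m (contFrac a b j l)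

  module _ (S≉0 : ∀ k m → S k (suc m) ≉ 0#) (Δ≉0 : ∀ k m → Δ k m ≉ 0#) where

    tail-suc : ∀ a b k m j l → a j ≈ θ² v k → b j ≈ (θ² u k - θ² v k) / u k →
               a (1 +ℕ j) ≈ θ v (1 +ℕ k) → b (1 +ℕ j) ≈ u (1 +ℕ k) →
               Tail a b (1 +ℕ k) m (2 +ℕ j) l → Tail a b k (suc m) j (2 +ℕ l)
    tail-suc a b k m j l a≈ b≈ a′≈ b′≈ (wd , T′-value) = (proj₁ step , b′+T′≉0 , wd) , proj₂ step
      where
      a≈θ²′ : a j K.≈ θ²′ v k
      a≈θ²′ = K.trans a≈ (K.reflexive (θ²-quotient v k))
      b≈θ²′ : b j K.≈ (θ²′ u k K.+ K.- θ²′ v k) K.* inv (u k)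
      b≈θ²′ = K.trans b≈ (K.reflexive (≡.trans
        (≡.cong₂ (λ p q → (p - q) / u k) (θ²-quotient u k) (θ²-quotient v k))
        (minus-div (θ²′ u k) (θ²′ v k) (u k))))
      b′+T′≉0 : b (1 +ℕ j) K.+ contFrac a b (2 +ℕ j) l ≉ 0#
      b′+T′≉0 = b+T≉0 S≉0 Δ≉0 {1 +ℕ k} {m} {b (1 +ℕ j)} {contFrac a b (2 +ℕ j) l} b′≈ T′-value
      step : b j K.+ contFrac a b (1 +ℕ j) (1 +ℕ l) ≉ 0# ×
             TailValue k (suc m) (contFrac a b j (2 +ℕ l))
      step = tailValue-suc S≉0 Δ≉0 {k} {m} {a j} {b j} {a (1 +ℕ j)} {b (1 +ℕ j)}
        {contFrac a b j (2 +ℕ l)} {contFrac a b (1 +ℕ j) (1 +ℕ l)} {contFrac a b (2 +ℕ j) l}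
        a≈θ²′ b≈θ²′ a′≈ b′≈ (contFrac-suc a b j (1 +ℕ l)) (contFrac-suc a b (1 +ℕ j) l) T′-value

    head : ∀ a b m l → u 0 ≈ 1# → v 0 ≈ 1# →
           a 1 ≈ v 1 → b 1 ≈ u 1 - v 1 → a 2 ≈ θ v 0 → b 2 ≈ u 0 → Tail a b 0 m 3 l →
           WellDefined a b 1 (2 +ℕ l) × S 1 (suc m) ≈ contFrac a b 1 (2 +ℕ l)
    head a b m l u₀≈1 v₀≈1 a₁≈ b₁≈ a₂≈ b₂≈ (wd , T-value) =
      (proj₁ step , b₂+T≉0 , wd) , K.trans (proj₂ step) (K.sym (contFrac-suc a b 1 (1 +ℕ l)))
      where
      b₂+T≉0 : b 2 K.+ contFrac a b 3 l ≉ 0#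
      b₂+T≉0 = b+T≉0 S≉0 Δ≉0 {0} {m} {b 2} {contFrac a b 3 l} b₂≈ T-value
      step : b 1 K.+ contFrac a b 2 (1 +ℕ l) ≉ 0# ×
             S 1 (suc m) K.≈ a 1 K.* inv (b 1 K.+ contFrac a b 2 (1 +ℕ l))
      step = head-value S≉0 Δ≉0 {m} {a 1} {b 1} {a 2} {b 2}
        {contFrac a b 2 (1 +ℕ l)} {contFrac a b 3 l}
        u₀≈1 v₀≈1 a₁≈ b₁≈ a₂≈ b₂≈ (contFrac-suc a b 2 l) T-value

    expansion : (a b : ℕ → Fraction) →
        u 0 ≈ 1# →
        v 0 ≈ 1# →
        a 1 ≈ v 1 →
        b 1 ≈ u 1 - v 1 →
        (∀ k → a (2 *ℕ suc k) ≈ θ v k) →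
        (∀ k → a (2 *ℕ suc k +ℕ 1) ≈ θ² v k) →
        (∀ k → b (2 *ℕ suc k) ≈ u k) →
        (∀ k → b (2 *ℕ suc k +ℕ 1) ≈ (θ² u k - θ² v k) / u k) →
        (n : ℕ) → 1 ≤ n →
        WellDefined a b 1 (2 *ℕ n) ×
        (∑[ k < n ] (v (suc (toℕ k)) / u (suc (toℕ k))) ≈ contFrac a b 1 (2 *ℕ n))
    expansion a b u₀≈1 v₀≈1 a₁≈ b₁≈ a-even a-odd b-even b-odd (suc m) (s≤s _) =
      -- The length is rewritten as 2 + 2m so that the two top levels unfold.
      subst (λ l → WellDefined a b 1 l ×
                   (∑[ k < suc m ] (v (suc (toℕ k)) / u (suc (toℕ k))) ≈ contFrac a b 1 l))
        (≡.sym (ℕ.*-suc 2 m))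
        (proj₁ value , K.trans (K.reflexive (S-sum 1 (suc m))) (proj₂ value))
      where
      2k+4≡ : ∀ k → suc (2 *ℕ suc k +ℕ 1) ≡ 2 *ℕ (2 +ℕ k)
      2k+4≡ k = ≡.trans (cong suc (ℕ.+-comm (2 *ℕ suc k) 1)) (≡.sym (ℕ.*-suc 2 (suc k)))

      2k+5≡ : ∀ k → 2 *ℕ (2 +ℕ k) +ℕ 1 ≡ 2 +ℕ (2 *ℕ suc k +ℕ 1)
      2k+5≡ k = ≡.trans (ℕ.+-comm (2 *ℕ (2 +ℕ k)) 1) (cong suc (≡.sym (2k+4≡ k)))

      -- Descending induction on k, as structural recursion on `m`: k + m stays fixed.
      tail : ∀ k m → Tail a b k m (2 *ℕ suc k +ℕ 1) (2 *ℕ m)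
      tail k zero    = tt , tailValue-zero k
      tail k (suc m) =
        subst (Tail a b k (suc m) (2 *ℕ suc k +ℕ 1)) (≡.sym (ℕ.*-suc 2 m))
          (tail-suc a b k m (2 *ℕ suc k +ℕ 1) (2 *ℕ m) (a-odd k) (b-odd k)
            (subst (λ i → a i ≈ θ v (1 +ℕ k)) (≡.sym (2k+4≡ k)) (a-even (1 +ℕ k)))
            (subst (λ i → b i ≈ u (1 +ℕ k)) (≡.sym (2k+4≡ k)) (b-even (1 +ℕ k)))
            (subst (λ i → Tail a b (1 +ℕ k) m i (2 *ℕ m)) (2k+5≡ k) (tail (1 +ℕ k) m)))

      value : WellDefined a b 1 (2 +ℕ 2 *ℕ m) × S 1 (suc m) ≈ contFrac a b 1 (2 +ℕ 2 *ℕ m)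
      value = head a b m (2 *ℕ m) u₀≈1 v₀≈1 a₁≈ b₁≈ (a-even 0) (b-even 0) (tail 0 m)

-- Nonvanishing by evaluation at the all-ones point

open Tails x y x≉0 y≉0

ones : Point
ones _ = 1ℚ

infix 4 _↦_

-- f ↦ r: the fraction f is defined when every indeterminate is 1, with value r.
record _↦_ (f : Fraction) (r : ℚ) : Set where
  field
    den≢0 : ev ones (den f) ≢ 0ℚ
    value : ev ones (num f) ≡ r ℚ.* ev ones (den f)
open _↦_

num≢0 : ∀ {f r} → f ↦ r → r ≢ 0ℚ → ev ones (num f) ≢ 0ℚ
num≢0 f↦r r≢0 e = *-≢0 r≢0 (den≢0 f↦r) (≡.trans (≡.sym (value f↦r)) e)

-- A fraction equal to 0 has the zero polynomial as numerator, which would vanish at `ones`.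
↦-≉0 : ∀ {f r} → f ↦ r → r ≢ 0ℚ → f ≉ 0#
↦-≉0 f↦r r≢0 f≈0 = num≢0 f↦r r≢0 (ev-cong ones (≃0⇒num≈0 f≈0))

↦-fromR : ∀ p → fromR p ↦ ev ones p
↦-fromR p = record { den≢0 = λ () ; value = ≡.sym (ℚ.*-identityʳ _) }

↦-+ : ∀ {f g r s} → f ↦ r → g ↦ s → f + g ↦ r ℚ.+ s
↦-+ {f} {g} {r} {s} f↦r g↦s = record
  { den≢0 = *-≢0 (den≢0 f↦r) (den≢0 g↦s)
  ; value = ≡.trans
      (≡.cong₂ (λ m n → m ℚ.* ev ones (den g) ℚ.+ n ℚ.* ev ones (den f)) (value f↦r) (value g↦s))
      (solve 4 (λ r s c d → (r :* c) :* d :+ (s :* d) :* c := (r :+ s) :* (c :* d)) ≡.refl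
        r s (ev ones (den f)) (ev ones (den g)))
  }
  where open ℚSolver.+-*-Solver

↦-* : ∀ {f g r s} → f ↦ r → g ↦ s → f * g ↦ r ℚ.* s
↦-* {f} {g} {r} {s} f↦r g↦s = record
  { den≢0 = *-≢0 (den≢0 f↦r) (den≢0 g↦s)
  ; value = ≡.trans (≡.cong₂ ℚ._*_ (value f↦r) (value g↦s))
      (solve 4 (λ r s c d → (r :* c) :* (s :* d) := (r :* s) :* (c :* d)) ≡.refl
        r s (ev ones (den f)) (ev ones (den g)))
  }
  where open ℚSolver.+-*-Solver

↦-neg : ∀ {f r} → f ↦ r → - f ↦ ℚ.- r
↦-neg {f} {r} f↦r = record
  { den≢0 = den≢0 f↦r
  ; value = ≡.trans (cong ℚ.-_ (value f↦r)) (ℚ.neg-distribˡ-* r (ev ones (den f)))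
  }

↦-inv : ∀ {f} → f ↦ 1ℚ → inv f ↦ 1ℚ
↦-inv {f} f↦1 with num f ≋0?
-- The default case of `inv` is impossible: the numerator has a nonzero value at `ones`.
... | yes e = contradiction (ev-cong ones e) (num≢0 f↦1 λ ())
... | no  _ = record
  { den≢0 = num≢0 f↦1 λ ()
  ; value = ≡.sym (≡.trans (ℚ.*-identityˡ _) (≡.trans (value f↦1) (ℚ.*-identityˡ _)))
  }

s↦1 : ∀ k → s k ↦ 1ℚ
s↦1 k = ↦-* (y↦1 k) (↦-inv (x↦1 k))
  where
  x↦1 : ∀ k → x k ↦ 1ℚ
  x↦1 zero    = ↦-fromR _
  x↦1 (suc i) = ↦-fromR _
  y↦1 : ∀ k → y k ↦ 1ℚ
  y↦1 zero    = ↦-fromR _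
  y↦1 (suc i) = ↦-fromR _

-- Only the sign of the value is recorded: one more summand 1 makes it positive.
S↦ : ∀ k m → ∃[ r ] (0ℚ ℚ.≤ r × S k m ↦ r)
S↦ k zero    = 0ℚ , ℚ.≤-refl , ↦-fromR _
S↦ k (suc m) =
  let r , 0≤r , S↦r = S↦ (suc k) m
  in 1ℚ ℚ.+ r , ℚ.+-mono-≤ {0ℚ} {1ℚ} (ℚ.nonNegative⁻¹ 1ℚ) 0≤r , ↦-+ (s↦1 k) S↦r

S≉0 : ∀ k m → S k (suc m) ≉ 0#
S≉0 k m =
  let r , 0≤r , S↦r = S↦ (suc k) m
  in ↦-≉0 (↦-+ (s↦1 k) S↦r) λ e →
       ℚ.<⇒≢ (ℚ.+-mono-<-≤ {0ℚ} {1ℚ} (ℚ.positive⁻¹ 1ℚ) 0≤r) (≡.sym e)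

-- Both products contain `S (2 +ℕ k) m`, whose value `r` cancels and leaves 1.
Δ≉0 : ∀ k m → Δ k m ≉ 0#
Δ≉0 k m =
  let r , _ , S↦r = S↦ (2 +ℕ k) m
  in ↦-≉0 (↦-+ (↦-* (s↦1 (1 +ℕ k)) (↦-+ (s↦1 (1 +ℕ k)) S↦r)) (↦-neg (↦-* (s↦1 k) S↦r)))
       (λ e → contradiction (≡.trans (≡.sym (Δ-value r)) e) λ ())
  where
  open ℚSolver.+-*-Solver
  Δ-value : ∀ r → 1ℚ ℚ.* (1ℚ ℚ.+ r) ℚ.+ ℚ.- (1ℚ ℚ.* r) ≡ 1ℚ
  Δ-value = solve 1 (λ r → con 1ℚ :* (con 1ℚ :+ r) :+ (:- (con 1ℚ :* r)) := con 1ℚ) ≡.refl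

theorem2 : (a b : ℕ → Fraction) →
    a 1 ≈ y 1 →
    b 1 ≈ x 1 - y 1 →
    (∀ k → a (2 *ℕ suc k) ≈ θ y k) →
    (∀ k → a (2 *ℕ suc k +ℕ 1) ≈ θ² y k) →
    (∀ k → b (2 *ℕ suc k) ≈ x k) →
    (∀ k → b (2 *ℕ suc k +ℕ 1) ≈ (θ² x k - θ² y k) / x k) →
    (n : ℕ) → 1 ≤ n →
    WellDefined a b 1 (2 *ℕ n) ×
    (∑[ k < n ] (y (suc (toℕ k)) / x (suc (toℕ k))) ≈ contFrac a b 1 (2 *ℕ n))
-- `x 0` and `y 0` are `1#` by definition, so both initial conditions hold by reflexivity.
theorem2 a b = Expansion.expansion x y x≉0 y≉0 S≉0 Δ≉0 a b K.refl K.refl
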